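{- Let $\phi_{\mathrm{xor}}$ be a conjunction of xor-clauses and $l_1,\dots,l_k$ xor-assumption literals. Let $G=\langle V,E,L\rangle$ be a UP-derivation on $\phi_{\mathrm{xor}}\wedge l_1\wedge\dots\wedge l_k$, let $v$ be a node in it, and let $W=\langle V_a,V_b\rangle$ be a cut for $v$. Then $\phi_{\mathrm{xor}}\models \mathit{Expl}_{\oplus}(v,W)\Leftrightarrow L(v)$, where $\mathit{Expl}_{\oplus}(v,W)$ is the parity explanation of $v$ under $W$.
   Context: **Xor-clauses.** An atom is a propositional variable or the constant $\top$ (true); a literal is an atom or its negation; $\bot$ denotes $\neg\top$, and $\neg\neg A$ is $A$. An xor-clause is an expression $l_1\oplus\dots\oplus l_n$ of literals ($\oplus$ is exclusive or), always taken in normal form: each atom occurs at most once and all literals are positive. The normal form (unique up to reordering) is obtained by the rewrite rules $\neg A\oplus C\leadsto A\oplus\top\oplus C$ and $A\oplus A\oplus C\leadsto C$. The empty xor-clause $()$ is identified with $\bot$. An xor-clause is unary if it is $x$ or $x\oplus\top$ for a variable $x$; $x\oplus\top$ is identified with the literal $\neg x$. The expression $C[A/D]$ denotes the normal form of the xor-clause obtained from $C$ by substituting all occurrences of the atom $A$ with $D$. An xor-clause is satisfied by a truth assignment (total on its variables and making $\top$ true) iff an odd number of its literals are true. $\phi\models\phi'$ means that every truth assignment (to all variables involved) satisfying $\phi$ satisfies $\phi'$. **UP-derivations.** Let $\psi=\phi_{\mathrm{xor}}\wedge l_1\wedge\dots\wedge l_k$, where $\phi_{\mathrm{xor}}$ is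 a conjunction of xor-clauses and the literals $l_i$ (xor-assumptions) are viewed as unary xor-clauses. The inference rules are, for a variable $x$ and an xor-clause $C$ (in normal form) in which $x$ occurs: from $x$ and $C$ derive $C[x/\top]$; from $x\oplus\top$ and $C$ derive $C[x/\bot]$. A UP-derivation on $\psi$ is a finite vertex-labeled directed acyclic graph $G=\langle V,E,L\rangle$, each vertex $v$ being labeled with an xor-clause $L(v)$, such that each vertex $v$ either has no incoming edges (an input vertex) and $L(v)$ is an xor-clause in $\psi$, or has exactly two incoming edges, originating from vertices $v_1,v_2$, and $L(v)$ is derived from $L(v_1)$ and $L(v_2)$ by one of the inference rules. **Cuts.** A cut of $G$ is a partitioning $(V_a,V_b)$ of $V$. A cut for a non-input vertex $v$ is a cut such that $v\in V_b$ and every input vertex from which there is a path to $v$ is in $V_a$. **Parity explanation.** For a node $v$ and a cut $W=\langle V_a,V_b\rangle$ for $v$, $\mathit{Expl}_{\oplus}(v,W)=f_W(v)$ (an xor-clause in normal form), where $f_W$ is defined recursively: (E1) if $u$ is an input node with $L(u)\in\phi_{\mathrm{xor}}$, then $f_W(u)=\top$; (E2) if $u$ is an input node with $L(u)\in\{l_1,\dots,l_k\}$, then $f_W(u)=L(u)$; (E3) if $u$ is a non-input node in $V_a$, then $f_W(u)=L(u)$; (E4) if $u$ is a non-input node in $V_b$, then $f_W(u)=f_W(u_1)\oplus f_W(u_2)\oplus\top$, where $u_1,u_2$ are the source nodes of the two edges incoming to $u$. -}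

module Defs where

open import Data.Bool.Base using (Bool; true)
open import Data.Fin.Base using (Fin)
open import Data.Fin.Induction using (spo-wellFounded)
open import Data.Fin.Subset using (Subset; _∈_; ∁)
open import Data.Fin.Subset.Properties using (_∈?_)
open import Data.List.Base using (List; []; _∷_; _++_; map; concatMap; filterᵇ; length)
open import Data.List.Membership.Propositional using () renaming (_∈_ to _∈ˡ_)
open import Data.List.Relation.Binary.Permutation.Propositional
  using (_↭_; refl; prep; swap; trans)
open import Data.List.Relation.Unary.All as All using (All; []; _∷_)
open import Data.List.Relation.Unary.AllPairs using ([]; _∷_)
open import Data.List.Relation.Unary.Any using (Any)
open import Data.List.Relation.Unary.Unique.Propositional using (Unique)
open import Data.Nat.Base using (ℕ; _%_)
open import Data.Product.Base using (_×_; _,_)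
open import Data.Sum.Base using (_⊎_; inj₁; inj₂)
open import Function.Base using (_∘_)
open import Function.Bundles using (_⇔_)
open import Induction.WellFounded using (WellFounded; Acc; acc)
open import Relation.Binary.Construct.Closure.ReflexiveTransitive
  using (Star; ε; _◅_; _◅◅_)
open import Relation.Binary.Construct.Closure.Transitive as Plus
  using (TransClosure)
open import Relation.Binary.Definitions using (DecidableEquality)
open import Relation.Binary.PropositionalEquality
  using (_≡_; _≢_; refl; sym; cong; subst; isEquivalence)
open import Relation.Nullary using (¬_; yes; no)
open import Relation.Nullary.Decidable using (map′)

module XorReasoning (Var : Set) (_≟_ : DecidableEquality Var) where

  data Atom : Set where
    ⊤   : Atom
    var : Var → Atom

  _≟ᴬ_ : DecidableEquality Atom
  ⊤     ≟ᴬ ⊤     = yes refl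
  ⊤     ≟ᴬ var _ = no λ ()
  var _ ≟ᴬ ⊤     = no λ ()
  var x ≟ᴬ var y = map′ (cong var) (λ { refl → refl }) (x ≟ y)

  data Literal : Set where
    pos neg : Atom → Literal

  -- Xor-clauses in normal form: all literals are positive, so only the
  -- atoms are kept.
  record XorClause : Set where
    constructor clause
    field
      atoms  : List Atom
      unique : Unique atoms

  open XorClause public

  -- The normal form is unique only up to reordering, so this is the
  -- equality of xor-clauses.
  infix 4 _≋_
  _≋_ : XorClause → XorClause → Set
  C ≋ D = atoms C ↭ atoms D

  ----------------------------------------------------------------------
  -- Normal forms

  -- The normal form of A ⊕ C, for C in normal form.
  toggle : Atom → List Atom → List Atom
  toggle A []      = A ∷ []
  toggle A (B ∷ C) with A ≟ᴬ B
  ... | yes _ = C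
  ... | no  _ = B ∷ toggle A C

  private
    toggle-All : ∀ {P : Atom → Set} {A} C → P A → All P C → All P (toggle A C)
    toggle-All         []      pA []         = pA ∷ []
    toggle-All {A = A} (B ∷ C) pA (pB ∷ pC) with A ≟ᴬ B
    ... | yes _ = pC
    ... | no  _ = pB ∷ toggle-All C pA pC

  toggle-unique : ∀ A C → Unique C → Unique (toggle A C)
  toggle-unique A []      []         = [] ∷ []
  toggle-unique A (B ∷ C) (B∉C ∷ uC) with A ≟ᴬ B
  ... | yes _   = uC
  ... | no  A≢B = toggle-All C (A≢B ∘ sym) B∉C ∷ toggle-unique A C uC

  normalise : List Literal → List Atom
  normalise []          = []
  normalise (pos A ∷ C) = toggle A (normalise C)
  normalise (neg A ∷ C) = toggle A (toggle ⊤ (normalise C))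

  normalise-unique : ∀ C → Unique (normalise C)
  normalise-unique []          = []
  normalise-unique (pos A ∷ C) =
    toggle-unique A _ (normalise-unique C)
  normalise-unique (neg A ∷ C) =
    toggle-unique A _ (toggle-unique ⊤ _ (normalise-unique C))

  nf : List Literal → XorClause
  nf C = clause (normalise C) (normalise-unique C)

  literals : XorClause → List Literal
  literals C = map pos (atoms C)

  -- The rewrite rules that define normal forms, modulo reordering;
  -- nf-rewrites shows that nf computes the result of rewriting with them.
  infix 4 _⇝_
  data _⇝_ : List Literal → List Literal → Set where
    reorder : ∀ {C D} → C ↭ D → C ⇝ D
    ¬-elim  : ∀ {A C} → neg A ∷ C ⇝ pos A ∷ pos ⊤ ∷ C
    cancel  : ∀ {A C} → pos A ∷ pos A ∷ C ⇝ C

  private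
    ⇝-prep : ∀ l {C D} → Star _⇝_ C D → Star _⇝_ (l ∷ C) (l ∷ D)
    ⇝-prep l ε                = ε
    ⇝-prep l (reorder p ◅ rs) = reorder (prep l p) ◅ ⇝-prep l rs
    ⇝-prep l (¬-elim ◅ rs)    =
      reorder (swap l _ refl) ◅ ¬-elim ◅
      reorder (trans (prep _ (swap _ l refl)) (swap _ l refl)) ◅ ⇝-prep l rs
    ⇝-prep l (cancel ◅ rs)    =
      reorder (trans (swap l _ refl) (prep _ (swap l _ refl))) ◅ cancel ◅
      ⇝-prep l rs

    toggle-rewrites : ∀ A C → Star _⇝_ (pos A ∷ map pos C) (map pos (toggle A C))
    toggle-rewrites A []      = ε
    toggle-rewrites A (B ∷ C) with A ≟ᴬ B
    ... | yes refl = cancel ◅ ε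
    ... | no  _    =
      reorder (swap (pos A) (pos B) refl) ◅ ⇝-prep (pos B) (toggle-rewrites A C)

  nf-rewrites : ∀ C → Star _⇝_ C (literals (nf C))
  nf-rewrites []          = ε
  nf-rewrites (pos A ∷ C) =
    ⇝-prep (pos A) (nf-rewrites C) ◅◅ toggle-rewrites A _
  nf-rewrites (neg A ∷ C) =
    ¬-elim ◅
    (⇝-prep (pos A) (⇝-prep (pos ⊤) (nf-rewrites C) ◅◅ toggle-rewrites ⊤ _)
     ◅◅ toggle-rewrites A _)

  -- A literal viewed as an xor-clause; ⌈ neg ⊤ ⌉ is the empty clause.
  ⌈_⌉ : Literal → XorClause
  ⌈ l ⌉ = nf (l ∷ [])

  infixl 6 _⊕_
  _⊕_ : XorClause → XorClause → XorClause
  C ⊕ D = nf (literals C ++ literals D)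

  infix 8 _[_/_]
  _[_/_] : XorClause → Atom → XorClause → XorClause
  C [ A / D ] = nf (concatMap replace (atoms C))
    where
    replace : Atom → List Literal
    replace B with A ≟ᴬ B
    ... | yes _ = literals D
    ... | no  _ = pos B ∷ []

  ----------------------------------------------------------------------
  -- Semantics

  Assignment : Set
  Assignment = Var → Bool

  value : Assignment → Atom → Bool
  value τ ⊤       = true
  value τ (var x) = τ x

  infix 4 _⊩_
  _⊩_ : Assignment → XorClause → Set
  τ ⊩ C = length (filterᵇ (value τ) (atoms C)) % 2 ≡ 1

  infix 5 _⟺_
  _⟺_ : XorClause → XorClause → Assignment → Set
  (C ⟺ D) τ = τ ⊩ C ⇔ τ ⊩ D

  infix 4 _⊨_
  _⊨_ : List XorClause → (Assignment → Set) → Set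
  φ ⊨ P = ∀ τ → All (τ ⊩_) φ → P τ

  ----------------------------------------------------------------------
  -- UP-derivations

  -- P , C ⊢ D: from the unary clause P and the clause C derive D.
  infix 4 _,_⊢_
  data _,_⊢_ (P C D : XorClause) : Set where
    ⊕-unit⁺ : ∀ x → P ≋ ⌈ pos (var x) ⌉ → var x ∈ˡ atoms C →
              D ≋ C [ var x / ⌈ pos ⊤ ⌉ ] → P , C ⊢ D
    ⊕-unit⁻ : ∀ x → P ≋ ⌈ neg (var x) ⌉ → var x ∈ˡ atoms C →
              D ≋ C [ var x / ⌈ neg ⊤ ⌉ ] → P , C ⊢ D

  module _ {n : ℕ} (_⟶_ : Fin n → Fin n → Set) (L : Fin n → XorClause) where

    NoIncoming : Fin n → Set
    NoIncoming v = ∀ u → ¬ (u ⟶ v)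

    record IsInput (φ : List XorClause) (ls : List Literal) (v : Fin n) : Set where
      field
        noIncoming : NoIncoming v
        -- When L v occurs both in φ and among the assumptions, this records
        -- which of the two origins v has.
        origin     : Any (λ C → L v ≋ C) φ ⊎ Any (λ l → L v ≋ ⌈ l ⌉) ls

    record IsDerived (v : Fin n) : Set where
      field
        v₁ v₂    : Fin n
        distinct : v₁ ≢ v₂
        edge₁    : v₁ ⟶ v
        edge₂    : v₂ ⟶ v
        only     : ∀ u → u ⟶ v → u ≡ v₁ ⊎ u ≡ v₂
        rule     : L v₁ , L v₂ ⊢ L v

  record UPDerivation (φ : List XorClause) (ls : List Literal) : Set₁ where
    infix 4 _⟶_
    field
      size    : ℕ
      _⟶_     : Fin size → Fin size → Set
      L       : Fin size → XorClause
      acyclic : ∀ v → ¬ TransClosure _⟶_ v v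
      node    : ∀ v → IsInput _⟶_ L φ ls v ⊎ IsDerived _⟶_ L v

    Vertex : Set
    Vertex = Fin size

    Input : Vertex → Set
    Input = NoIncoming _⟶_ L

    ⟶⁺-wellFounded : WellFounded (TransClosure _⟶_)
    ⟶⁺-wellFounded = spo-wellFounded record
      { isEquivalence = isEquivalence
      ; irrefl        = λ { refl → acyclic _ }
      ; trans         = Plus._++_
      ; <-resp-≈      = (λ { refl p → p }) , (λ { refl p → p })
      }

    -- A cut is given by its part V_a.
    Cut : Set
    Cut = Subset size

    Vᵃ Vᵇ : Cut → Subset size
    Vᵃ W = W
    Vᵇ W = ∁ W

    record IsCutFor (v : Vertex) (W : Cut) : Set where
      field
        nonInput : ¬ Input v
        v∈Vᵇ     : v ∈ Vᵇ W
        inputs   : ∀ u → Input u → Star _⟶_ u v → u ∈ Vᵃ W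

    -- The function f_W, by recursion on the accessibility of u.
    parityExpl : Cut → ∀ u → Acc (TransClosure _⟶_) u → XorClause
    parityExpl W u (acc rec) with node u
    ... | inj₁ i with IsInput.origin i
    ...   | inj₁ _ = ⌈ pos ⊤ ⌉
    ...   | inj₂ _ = L u
    parityExpl W u (acc rec) | inj₂ d with u ∈? Vᵃ W
    ...   | yes _ = L u
    ...   | no  _ = parityExpl W v₁ (rec Plus.[ edge₁ ])
                  ⊕ parityExpl W v₂ (rec Plus.[ edge₂ ])
                  ⊕ ⌈ pos ⊤ ⌉
      where open IsDerived d

    Expl⊕ : Vertex → Cut → XorClause
    Expl⊕ v W = parityExpl W v (⟶⁺-wellFounded v)

{-# OPTIONS --safe #-}
module Submission where

-- Satisfaction of a clause is the exclusive or of the values of its atoms, so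
-- it turns ⊕ into xor.  A unit rule deriving C[x/b] from P says, as
-- x occurs exactly once in C, that C[x/b] and C ⊕ P ⊕ ⊤ have the same value
-- under every assignment.  This is the equation (E4) for f_W, hence f_W(u) and
-- L(u) have the same value at every node u, by induction along the edges.

open import Defs
open import Data.Bool.Base using (Bool; true; false; not; _xor_; if_then_else_)
open import Data.Bool.Properties using (xor-assoc; xor-identityʳ)
open import Data.Bool.Solver using (module xor-∧-Solver)
open import Data.Fin.Subset.Properties using (_∈?_)
open import Data.List.Base using (List; []; _∷_; _++_; map; concatMap; filterᵇ; length; foldr)
open import Data.List.Membership.Propositional using (_∈_)
open import Data.List.Relation.Binary.Permutation.Propositional
  using (_↭_; refl; prep; swap; trans)
open import Data.List.Relation.Unary.All as All using (All; []; _∷_)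
open import Data.List.Relation.Unary.AllPairs using (_∷_)
open import Data.List.Relation.Unary.Any using (Any; here; there)
open import Data.List.Relation.Unary.Unique.Propositional using (Unique)
open import Data.Nat.Base using (_+_; _%_)
open import Data.Nat.DivMod using (%-distribˡ-+)
open import Data.Product.Base using (∃; _,_; proj₁)
open import Data.Sum.Base using (inj₁; inj₂)
open import Function.Base using (_∘_)
open import Function.Bundles using (mk⇔)
open import Induction.WellFounded using (Acc; acc)
open import Relation.Binary.Construct.Closure.Transitive as Plus using (TransClosure)
open import Relation.Binary.Definitions using (DecidableEquality)
open import Relation.Binary.PropositionalEquality
  using (_≡_; _≢_; refl; sym; cong; cong₂; module ≡-Reasoning)
  renaming (trans to ≡-trans)
open import Relation.Nullary using (yes; no; contradiction)

open xor-∧-Solver using (solve; _:+_; _:=_; con)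

xor-leftComm : ∀ a b c → a xor (b xor c) ≡ b xor (a xor c)
xor-leftComm = solve 3 (λ a b c → a :+ (b :+ c) := b :+ (a :+ c)) refl

xor-cancelˡ : ∀ a b → a xor (a xor b) ≡ b
xor-cancelˡ = solve 2 (λ a b → a :+ (a :+ b) := b) refl

module Parity (Var : Set) (_≟_ : DecidableEquality Var) where
  open XorReasoning Var _≟_

  module _ (τ : Assignment) where
    open ≡-Reasoning

    -- Satisfaction as parity

    parity : List Atom → Bool
    parity = foldr (λ A b → value τ A xor b) false

    litValue : Literal → Bool
    litValue (pos A) = value τ A
    litValue (neg A) = not (value τ A)

    litParity : List Literal → Bool
    litParity = foldr (λ l b → litValue l xor b) false

    ⟦_⟧ : XorClause → Bool
    ⟦ C ⟧ = parity (atoms C)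

    -- The bridge from the counting definition of `⊩` to `xor`: a true atom raises the count by one
    -- and flips the parity, a false one changes neither.
    count-mod-2 : ∀ As →
      length (filterᵇ (value τ) As) % 2 ≡ (if parity As then 1 else 0)
    count-mod-2 [] = refl
    count-mod-2 (A ∷ As) with value τ A
    ... | false = count-mod-2 As
    ... | true  = begin
      (1 + length (filterᵇ (value τ) As)) % 2
        ≡⟨ %-distribˡ-+ 1 (length (filterᵇ (value τ) As)) 2 ⟩
      (1 + length (filterᵇ (value τ) As) % 2) % 2
        ≡⟨ cong (λ m → (1 + m) % 2) (count-mod-2 As) ⟩
      (1 + (if parity As then 1 else 0)) % 2
        ≡⟨ flip (parity As) ⟩
      (if not (parity As) then 1 else 0) ∎
      where
      flip : ∀ b → (1 + (if b then 1 else 0)) % 2 ≡ (if not b then 1 else 0)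
      flip true  = refl
      flip false = refl

    ⊩⇒true : ∀ C → τ ⊩ C → ⟦ C ⟧ ≡ true
    ⊩⇒true C p with ⟦ C ⟧ | count-mod-2 (atoms C)
    ... | true  | _ = refl
    ... | false | q = contradiction (≡-trans (sym p) q) λ ()

    ⟦⟧-cong⇒⇔ : ∀ C D → ⟦ C ⟧ ≡ ⟦ D ⟧ → (C ⟺ D) τ
    -- `τ ⊩ C` unfolds to an equation with right-hand side `1`, so each direction is a composition
    -- with `count-eq`.
    ⟦⟧-cong⇒⇔ C D eq = mk⇔ (≡-trans (sym count-eq)) (≡-trans count-eq)
      where
      count-eq : length (filterᵇ (value τ) (atoms C)) % 2
               ≡ length (filterᵇ (value τ) (atoms D)) % 2
      count-eq = begin
        _ ≡⟨ count-mod-2 (atoms C) ⟩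
        _ ≡⟨ cong (if_then 1 else 0) eq ⟩
        _ ≡⟨ count-mod-2 (atoms D) ⟨
        _ ∎

    -- Parity of normal forms

    parity-↭ : ∀ {As Bs} → As ↭ Bs → parity As ≡ parity Bs
    parity-↭ refl         = refl
    parity-↭ (prep A p)   = cong (value τ A xor_) (parity-↭ p)
    parity-↭ (swap A B p) = ≡-trans
      (xor-leftComm (value τ A) (value τ B) _)
      (cong (λ b → value τ B xor (value τ A xor b)) (parity-↭ p))
    parity-↭ (trans p q)  = ≡-trans (parity-↭ p) (parity-↭ q)

    -- Whether `toggle` inserts `A` or deletes it, the effect is that of adding one more `A`, since
    -- two equal summands cancel under `xor`.
    parity-toggle : ∀ A As → parity (toggle A As) ≡ value τ A xor parity As
    parity-toggle A [] = refl
    parity-toggle A (B ∷ As) with A ≟ᴬ B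
    ... | yes refl = sym (xor-cancelˡ (value τ A) (parity As))
    ... | no  _    = ≡-trans
      (cong (value τ B xor_) (parity-toggle A As))
      (xor-leftComm (value τ B) (value τ A) (parity As))

    parity-normalise : ∀ ls → parity (normalise ls) ≡ litParity ls
    parity-normalise [] = refl
    parity-normalise (pos A ∷ ls) = ≡-trans
      (parity-toggle A (normalise ls))
      (cong (value τ A xor_) (parity-normalise ls))
    parity-normalise (neg A ∷ ls) = begin
      parity (toggle A (toggle ⊤ (normalise ls)))
        ≡⟨ parity-toggle A (toggle ⊤ (normalise ls)) ⟩
      value τ A xor parity (toggle ⊤ (normalise ls))
        ≡⟨ cong (value τ A xor_) (parity-toggle ⊤ (normalise ls)) ⟩
      value τ A xor (true xor parity (normalise ls))
        -- `true xor a` reduces to `not a`, so the extra `⊤` accounts for the negation.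
        ≡⟨ solve 2 (λ a b → a :+ (con true :+ b) := (con true :+ a) :+ b) refl
             (value τ A) (parity (normalise ls)) ⟩
      not (value τ A) xor parity (normalise ls)
        ≡⟨ cong (not (value τ A) xor_) (parity-normalise ls) ⟩
      not (value τ A) xor litParity ls ∎

    litParity-pos : ∀ As → litParity (map pos As) ≡ parity As
    litParity-pos []       = refl
    litParity-pos (A ∷ As) = cong (value τ A xor_) (litParity-pos As)

    litParity-++ : ∀ ks ls → litParity (ks ++ ls) ≡ litParity ks xor litParity ls
    litParity-++ []       ls = refl
    litParity-++ (k ∷ ks) ls = ≡-trans
      (cong (litValue k xor_) (litParity-++ ks ls))
      (sym (xor-assoc (litValue k) (litParity ks) (litParity ls)))

    ⟦⌈⌉⟧ : ∀ l → ⟦ ⌈ l ⌉ ⟧ ≡ litValue l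
    ⟦⌈⌉⟧ l = ≡-trans (parity-normalise (l ∷ [])) (xor-identityʳ (litValue l))

    ⟦⊕⟧ : ∀ C D → ⟦ C ⊕ D ⟧ ≡ ⟦ C ⟧ xor ⟦ D ⟧
    ⟦⊕⟧ C D = begin
      ⟦ C ⊕ D ⟧
        ≡⟨ parity-normalise (literals C ++ literals D) ⟩
      litParity (literals C ++ literals D)
        ≡⟨ litParity-++ (literals C) (literals D) ⟩
      litParity (literals C) xor litParity (literals D)
        ≡⟨ cong₂ _xor_ (litParity-pos (atoms C)) (litParity-pos (atoms D)) ⟩
      ⟦ C ⟧ xor ⟦ D ⟧ ∎

    -- Substitution and the unit rules

    module _ (A : Atom) (f : Atom → List Literal)
             (f-≢ : ∀ B → A ≢ B → litParity (f B) ≡ value τ B) where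

      litParity-concatMap-∉ : ∀ {As} → All (A ≢_) As →
        litParity (concatMap f As) ≡ parity As
      litParity-concatMap-∉ []                      = refl
      litParity-concatMap-∉ {B ∷ As} (A≢B ∷ A∉As) = ≡-trans
        (litParity-++ (f B) (concatMap f As))
        (cong₂ _xor_ (f-≢ B A≢B) (litParity-concatMap-∉ A∉As))

      -- By uniqueness `A` is met exactly once, and there `f A` takes its place. The term
      -- `value τ A xor parity As` is the parity of the other atoms, expressed without deleting `A`
      -- from the list.
      litParity-concatMap-∈ : ∀ {As} → Unique As → A ∈ As →
        litParity (concatMap f As) ≡ litParity (f A) xor (value τ A xor parity As)
      litParity-concatMap-∈ {_ ∷ As} (A∉As ∷ _) (here refl) = begin
        litParity (f A ++ concatMap f As)
          ≡⟨ litParity-++ (f A) (concatMap f As) ⟩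
        litParity (f A) xor litParity (concatMap f As)
          ≡⟨ cong (litParity (f A) xor_) (litParity-concatMap-∉ A∉As) ⟩
        litParity (f A) xor parity As
          ≡⟨ cong (litParity (f A) xor_) (xor-cancelˡ (value τ A) (parity As)) ⟨
        litParity (f A) xor (value τ A xor (value τ A xor parity As)) ∎
      litParity-concatMap-∈ {B ∷ As} (B∉As ∷ uAs) (there A∈As) = begin
        litParity (f B ++ concatMap f As)
          ≡⟨ litParity-++ (f B) (concatMap f As) ⟩
        litParity (f B) xor litParity (concatMap f As)
          -- The head `B` differs from `A` because `A` occurs in the tail and `B` does not.
          ≡⟨ cong₂ _xor_ (f-≢ B (All.lookup B∉As A∈As ∘ sym))
                         (litParity-concatMap-∈ uAs A∈As) ⟩
        value τ B xor (litParity (f A) xor (value τ A xor parity As))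
          ≡⟨ solve 4 (λ b d a c → b :+ (d :+ (a :+ c)) := d :+ (a :+ (b :+ c))) refl
               (value τ B) (litParity (f A)) (value τ A) (parity As) ⟩
        litParity (f A) xor (value τ A xor (value τ B xor parity As)) ∎

    -- Unification recovers the function local to the definition of _[_/_],
    -- which cannot be named from outside.
    replacement : ∀ C A D → ∃ λ f → C [ A / D ] ≡ nf (concatMap f (atoms C))
    replacement C A D = _ , refl

    replace : XorClause → Atom → XorClause → Atom → List Literal
    replace C A D = proj₁ (replacement C A D)

    litParity-replace-≡ : ∀ C A D → litParity (replace C A D A) ≡ ⟦ D ⟧
    litParity-replace-≡ C A D with A ≟ᴬ A
    ... | yes _   = litParity-pos (atoms D)
    ... | no  A≢A = contradiction refl A≢A

    litParity-replace-≢ : ∀ C A D B → A ≢ B →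
      litParity (replace C A D B) ≡ value τ B
    litParity-replace-≢ C A D B A≢B with A ≟ᴬ B
    ... | yes A≡B = contradiction A≡B A≢B
    ... | no  _   = xor-identityʳ (value τ B)

    ⟦[/]⟧ : ∀ C A D → A ∈ atoms C →
      ⟦ C [ A / D ] ⟧ ≡ ⟦ D ⟧ xor (value τ A xor ⟦ C ⟧)
    ⟦[/]⟧ C A D A∈C = begin
      ⟦ C [ A / D ] ⟧
        ≡⟨ parity-normalise (concatMap (replace C A D) (atoms C)) ⟩
      litParity (concatMap (replace C A D) (atoms C))
        ≡⟨ litParity-concatMap-∈ A (replace C A D) (litParity-replace-≢ C A D)
             (unique C) A∈C ⟩
      litParity (replace C A D A) xor (value τ A xor ⟦ C ⟧)
        ≡⟨ cong (_xor (value τ A xor ⟦ C ⟧)) (litParity-replace-≡ C A D) ⟩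
      ⟦ D ⟧ xor (value τ A xor ⟦ C ⟧) ∎

    -- In both rules the substituted constant xor `τ x` equals `⟦ P ⟧ xor true`: the constant is
    -- true when `P` is `x`, and false when `P` is its negation.
    ⟦⊢⟧ : ∀ {P C D} → P , C ⊢ D → ⟦ D ⟧ ≡ (⟦ P ⟧ xor ⟦ C ⟧) xor true
    ⟦⊢⟧ {P} {C} {D} (⊕-unit⁺ x P≋x x∈C D≋) = begin
      ⟦ D ⟧
        ≡⟨ parity-↭ D≋ ⟩
      ⟦ C [ var x / ⌈ pos ⊤ ⌉ ] ⟧
        ≡⟨ ⟦[/]⟧ C (var x) ⌈ pos ⊤ ⌉ x∈C ⟩
      true xor (τ x xor ⟦ C ⟧)
        ≡⟨ solve 2 (λ a c → con true :+ (a :+ c) := (a :+ c) :+ con true) refl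
             (τ x) ⟦ C ⟧ ⟩
      (τ x xor ⟦ C ⟧) xor true
        ≡⟨ cong (λ p → (p xor ⟦ C ⟧) xor true)
             (≡-trans (parity-↭ P≋x) (⟦⌈⌉⟧ (pos (var x)))) ⟨
      (⟦ P ⟧ xor ⟦ C ⟧) xor true ∎
    ⟦⊢⟧ {P} {C} {D} (⊕-unit⁻ x P≋¬x x∈C D≋) = begin
      ⟦ D ⟧
        ≡⟨ parity-↭ D≋ ⟩
      ⟦ C [ var x / ⌈ neg ⊤ ⌉ ] ⟧
        ≡⟨ ⟦[/]⟧ C (var x) ⌈ neg ⊤ ⌉ x∈C ⟩
      -- `⌈ neg ⊤ ⌉` normalises to the empty clause, so its summand `false` vanishes by computation.
      τ x xor ⟦ C ⟧
        ≡⟨ solve 2 (λ a c → a :+ c := ((con true :+ a) :+ c) :+ con true) refl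
             (τ x) ⟦ C ⟧ ⟩
      (not (τ x) xor ⟦ C ⟧) xor true
        ≡⟨ cong (λ p → (p xor ⟦ C ⟧) xor true)
             (≡-trans (parity-↭ P≋¬x) (⟦⌈⌉⟧ (neg (var x)))) ⟨
      (⟦ P ⟧ xor ⟦ C ⟧) xor true ∎

    -- Parity explanations

    ≋-any-true : ∀ {φ} C → All (τ ⊩_) φ → Any (C ≋_) φ → ⟦ C ⟧ ≡ true
    ≋-any-true C (τ⊩D ∷ _) (here {x = D} C≋D) = ≡-trans (parity-↭ C≋D) (⊩⇒true D τ⊩D)
    ≋-any-true C (_ ∷ τ⊩φ) (there C∈φ)        = ≋-any-true C τ⊩φ C∈φ

    module _ {φ : List XorClause} {ls : List Literal} (G : UPDerivation φ ls)
             (τ⊩φ : All (τ ⊩_) φ) where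
      open UPDerivation G

      -- The accessibility proof is arbitrary so that the induction can follow the recursion of
      -- `parityExpl`. At assumptions and at derived nodes in `Vᵃ W` both sides are the same clause;
      -- at derived nodes outside it, `⟦⊢⟧` matches (E4).
      ⟦parityExpl⟧ : ∀ W u (a : Acc (TransClosure _⟶_) u) →
        ⟦ parityExpl W u a ⟧ ≡ ⟦ L u ⟧
      ⟦parityExpl⟧ W u (acc rec) with node u
      ... | inj₁ i with IsInput.origin i
      -- The explanation `⌈ pos ⊤ ⌉` computes to `true`, and `L u` is true because `τ` satisfies
      -- `φ`.
      ...   | inj₁ Lu∈φ = sym (≋-any-true (L u) τ⊩φ Lu∈φ)
      ...   | inj₂ _    = refl
      ⟦parityExpl⟧ W u (acc rec) | inj₂ d with u ∈? Vᵃ W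
      ...   | yes _ = refl
      ...   | no  _ = begin
        ⟦ f₁ ⊕ f₂ ⊕ ⌈ pos ⊤ ⌉ ⟧
          ≡⟨ ⟦⊕⟧ (f₁ ⊕ f₂) ⌈ pos ⊤ ⌉ ⟩
        ⟦ f₁ ⊕ f₂ ⟧ xor true
          ≡⟨ cong (_xor true) (⟦⊕⟧ f₁ f₂) ⟩
        (⟦ f₁ ⟧ xor ⟦ f₂ ⟧) xor true
          ≡⟨ cong₂ (λ a b → (a xor b) xor true)
               (⟦parityExpl⟧ W v₁ (rec Plus.[ edge₁ ]))
               (⟦parityExpl⟧ W v₂ (rec Plus.[ edge₂ ])) ⟩
        (⟦ L v₁ ⟧ xor ⟦ L v₂ ⟧) xor true
          ≡⟨ ⟦⊢⟧ rule ⟨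
        ⟦ L u ⟧ ∎
        where
        open IsDerived d
        f₁ f₂ : XorClause
        f₁ = parityExpl W v₁ (rec Plus.[ edge₁ ])
        f₂ = parityExpl W v₂ (rec Plus.[ edge₂ ])

theorem1 : (Var : Set) (_≟_ : DecidableEquality Var) →
    let open XorReasoning Var _≟_ in
    (φ : List XorClause) (ls : List Literal) (G : UPDerivation φ ls) →
    let open UPDerivation G in
    (v : Vertex) (W : Cut) → IsCutFor v W →
    φ ⊨ (Expl⊕ v W ⟺ L v)
theorem1 Var _≟_ φ ls G v W _ τ τ⊩φ =
  ⟦⟧-cong⇒⇔ τ (Expl⊕ v W) (L v) (⟦parityExpl⟧ τ G τ⊩φ W v (⟶⁺-wellFounded v))
  where
  open Parity Var _≟_
  open XorReasoning Var _≟_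
  open UPDerivation G
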